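{- For every $n\ge1$ and every $\pi\in\mathrm{PC}(n)$ let $a(\pi)\in\mathbb{C}$ be an arbitrary complex number, and let $b(\pi)$ (for $\pi\in\mathrm{PC}^+(n)$) and $c(\pi)$ (for $\pi\in\mathrm{CO}(n)$) be the associated weights described in the context. Let $$B(x)=\sum_{n=1}^\infty b_nx^n,\quad b_n=\sum_{\pi\in\mathrm{PC}^+(n)}b(\pi),\qquad C(x)=\sum_{n=1}^\infty c_nx^n,\quad c_n=\sum_{\pi\in\mathrm{CO}(n)}c(\pi).$$ Then, as formal power series, $$C(x)=B\left(\frac{x}{1-x}\right).$$
   Context: $[n]=\{1,\ldots,n\}$ and $\mathcal{P}(n)$ is the set of all set partitions of $[n]$. For $\pi\in\mathcal{P}(n)$, write $i\overset{\pi}{\sim}j$ if $i,j$ lie in the same block of $\pi$. A subset $S\subseteq[n]$ splits $\pi$ if $S$ is a union of some of the blocks of $\pi$. Consider, for $\pi\in\mathcal{P}(n)$, $n\ge1$, the conditions: (a) no proper subinterval $\{p+1,p+2,\ldots,p+q\}$ of $[n]$ (with $0\le p<p+q\le n$ and $q<n$) splits $\pi$; (b) $k\not\overset{\pi}{\sim}k+1$ for all $k\in[n-1]$; (c) $1\not\overset{\pi}{\sim}n$. $\mathrm{PC}(n)$ is the set of $\pi\in\mathcal{P}(n)$ satisfying (a), (b), (c); $\mathrm{PC}^+(n)$ is the set of those satisfying (a) and (b); $\mathrm{CO}(n)$ (connected partitions) is the set of those satisfying (a). $0_1$ denotes the unique partition of $[1]$. One has $\mathrm{PC}^+(1)=\{0_1\}$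 and, for $n\ge2$, $\mathrm{PC}^+(n)$ is the disjoint union of $\mathrm{PC}(n)$ and $\{\tilde\sigma\mid\sigma\in\mathrm{PC}(n-1)\}$, where $\tilde\sigma$ is obtained from $\sigma$ by adjoining $n$ to the block of $\sigma$ that contains $1$. Weights $b$: $b(0_1)=1$; for $n\ge2$, $b(\pi)=a(\pi)$ if $\pi\in\mathrm{PC}(n)$ and $b(\tilde\sigma)=a(\sigma)$ for $\sigma\in\mathrm{PC}(n-1)$. For $1\le\ell\le n$, $\sigma\in\mathrm{PC}^+(\ell)$ and integers $k_1,\ldots,k_\ell\ge1$ with $k_1+\cdots+k_\ell=n$, let $I_j=\{k_1+\cdots+k_{j-1}+1,\ldots,k_1+\cdots+k_{j-1}+k_j\}$ and let $\Phi_n(\sigma,k_1,\ldots,k_\ell)=\{\bigcup_{j\in S}I_j\mid S\in\sigma\}$. The map $\Phi_n$ is a bijection from the set of all such tuples $(\sigma,k_1,\ldots,k_\ell)$ (over all $1\le\ell\le n$) onto $\mathrm{CO}(n)$. Weights $c$: $c(\pi)=b(\sigma)$ for $\pi\in\mathrm{CO}(n)$, where $\pi=\Phi_n(\sigma,k_1,\ldots,k_\ell)$. -}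

module Defs where

open import Algebra.Bundles using (CommutativeRing)
open import Data.Bool.Base using (Bool; true; false; _∧_)
open import Data.Fin.Base using (Fin; zero; suc; toℕ; fromℕ; inject₁)
open import Data.Fin.Properties using (all?; any?)
open import Data.Fin.Subset using (Subset; _∈_; ⋃)
open import Data.Fin.Subset.Properties using (_∈?_; anySubset?)
open import Data.List.Base as List using (List; []; _∷_; cartesianProductWith; mapMaybe)
open import Data.List.Membership.Propositional using () renaming (_∈_ to _∈ˡ_)
open import Data.List.Membership.Propositional.Properties
  using (∈-cartesianProductWith⁺)
open import Data.List.Relation.Unary.All using (All; []; _∷_)
open import Data.List.Relation.Unary.AllPairs using ([]; _∷_)
open import Data.List.Relation.Unary.Any using (here; there)
open import Data.List.Relation.Unary.Unique.Propositional using (Unique)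
open import Data.List.Relation.Unary.Unique.Propositional.Properties
  using (cartesianProductWith⁺)
open import Data.Maybe.Base as Maybe using (Maybe)
open import Data.Nat.Base using (ℕ; zero; suc; _+_; _∸_; _≤_; _<_)
open import Data.Nat.ListAction using (sum)
open import Data.Nat.Properties using (_≤?_; _<?_; allUpTo?)
open import Data.Product.Base using (_×_; _,_; ∃)
open import Data.Vec.Base as Vec using (Vec; []; _∷_; _∷ʳ_; lookup; tabulate)
open import Data.Vec.Properties using (≡-dec; ∷-injective)
open import Data.Vec.Relation.Unary.All as VecAll using ()
open import Function.Base using (_∘_)
open import Function.Bundles using (_⇔_)
open import Level using (_⊔_)
open import Relation.Binary.Definitions using (DecidableEquality)
open import Relation.Binary.PropositionalEquality
  using (_≡_; _≢_; refl; cong)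
open import Relation.Nullary.Decidable
  using (Dec; yes; no; does; ¬?; _×-dec_; _→-dec_; dec⇒maybe)
open import Relation.Nullary.Negation using (¬_)
open import Relation.Nullary.Negation.Core using (contradiction-irr)
open import Relation.Unary using (Pred; Decidable)

import Algebra.Definitions.RawMonoid as RawMonoidDefs
import Data.Bool.Properties as Bool

-- The element x of [n] = {1,…,n} is the i : Fin n with
-- toℕ i = x − 1.

_≟ˢ_ : ∀ {n} → DecidableEquality (Subset n)
_≟ˢ_ = ≡-dec Bool._≟_

-- A set partition is encoded by the table i ↦ (the block containing i).

IsBlockTable : ∀ {n} → Vec (Subset n) n → Set
IsBlockTable t =
  (∀ i → i ∈ lookup t i) ×
  (∀ i j → j ∈ lookup t i → lookup t j ≡ lookup t i)

isBlockTable? : ∀ {n} → Decidable (IsBlockTable {n})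
isBlockTable? t =
  all? (λ i → i ∈? lookup t i) ×-dec
  all? (λ i → all? λ j →
    (j ∈? lookup t i) →-dec (lookup t j ≟ˢ lookup t i))

-- Irrelevance makes _≡_ on Partition n agree with equality of partitions.

record Partition (n : ℕ) : Set where
  constructor partition
  field
    table         : Vec (Subset n) n
    .isBlockTable : IsBlockTable table

  blockOf : Fin n → Subset n
  blockOf = lookup table

open Partition public using (table; blockOf)

IsBlock : ∀ {n} → Partition n → Subset n → Set
IsBlock π S = ∃ λ i → S ≡ blockOf π i

SameBlock : ∀ {n} → Partition n → Fin n → Fin n → Set
SameBlock π i j = ∃ λ k → i ∈ blockOf π k × j ∈ blockOf π k

sameBlock? : ∀ {n} (π : Partition n) i j → Dec (SameBlock π i j)
sameBlock? π i j = any? λ k → (i ∈? blockOf π k) ×-dec (j ∈? blockOf π k)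

⋃[_] : ∀ {m n} → Subset m → (Fin m → Subset n) → Subset n
⋃[ T ] F = ⋃ (List.map F (List.filter (_∈? T) (List.allFin _)))

-- In the 1-based labelling: {p+1, …, p+q}.

interval : ∀ {n} → ℕ → ℕ → Subset n
interval p q = tabulate λ i → does (p ≤? toℕ i) ∧ does (toℕ i <? p + q)

Splits : ∀ {n} → Subset n → Partition n → Set
Splits S π = ∃ λ T → S ≡ ⋃[ T ] (blockOf π)

splits? : ∀ {n} (S : Subset n) (π : Partition n) → Dec (Splits S π)
splits? S π = anySubset? λ T → S ≟ˢ ⋃[ T ] (blockOf π)

words : ∀ {A : Set} → List A → ∀ n → List (Vec A n)
words xs zero    = [] ∷ []
words xs (suc n) = cartesianProductWith _∷_ xs (words xs n)

toPartition : ∀ {n} → Vec (Subset n) n → Maybe (Partition n)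
toPartition t = Maybe.map (λ p → partition t p) (dec⇒maybe (isBlockTable? t))

allTables : ∀ n → List (Vec (Subset n) n)
allTables n = words (words (true ∷ false ∷ []) n) n

allPartitions : ∀ n → List (Partition n)
allPartitions n = mapMaybe toPartition (allTables n)

private
  words-complete : ∀ {A : Set} {xs : List A} → (∀ x → x ∈ˡ xs) →
                   ∀ {n} (v : Vec A n) → v ∈ˡ words xs n
  words-complete h []      = here refl
  words-complete h (x ∷ v) =
    ∈-cartesianProductWith⁺ _∷_ (h x) (words-complete h v)

  words-unique : ∀ {A : Set} {xs : List A} → Unique xs →
                 ∀ n → Unique (words xs n)
  words-unique u zero    = [] ∷ []
  words-unique u (suc n) =
    cartesianProductWith⁺ _∷_ ∷-injective u (words-unique u n)

  bool-complete : ∀ b → b ∈ˡ (true ∷ false ∷ [])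
  bool-complete true  = here refl
  bool-complete false = there (here refl)

  bool-unique : Unique (true ∷ false ∷ [])
  bool-unique = ((λ ()) ∷ []) ∷ [] ∷ []

  ∈-mapMaybe : ∀ {n} (π : Partition n) ts → table π ∈ˡ ts →
               π ∈ˡ mapMaybe toPartition ts
  ∈-mapMaybe (partition t p) (t ∷ ts) (here refl) with isBlockTable? t
  ... | yes _ = here refl
  ... | no ¬p = contradiction-irr p ¬p
  ∈-mapMaybe π (t ∷ ts) (there π∈) with isBlockTable? t
  ... | yes _ = there (∈-mapMaybe π ts π∈)
  ... | no _  = ∈-mapMaybe π ts π∈

  mapMaybe-fresh : ∀ {n} {π : Partition n} ts → All (table π ≢_) ts →
                   All (π ≢_) (mapMaybe toPartition ts)
  mapMaybe-fresh []       []       = []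
  mapMaybe-fresh (t ∷ ts) (≢t ∷ h) with isBlockTable? t
  ... | yes _ = (≢t ∘ cong table) ∷ mapMaybe-fresh ts h
  ... | no _  = mapMaybe-fresh ts h

  mapMaybe-unique : ∀ {n} (ts : List (Vec (Subset n) n)) → Unique ts →
                    Unique (mapMaybe toPartition ts)
  mapMaybe-unique []       []      = []
  mapMaybe-unique (t ∷ ts) (h ∷ u) with isBlockTable? t
  ... | yes _ = mapMaybe-fresh ts h ∷ mapMaybe-unique ts u
  ... | no _  = mapMaybe-unique ts u

allPartitions-complete : ∀ {n} (π : Partition n) → π ∈ˡ allPartitions n
allPartitions-complete π =
  ∈-mapMaybe π _ (words-complete (words-complete bool-complete) (table π))

allPartitions-unique : ∀ n → Unique (allPartitions n)
allPartitions-unique n =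
  mapMaybe-unique _ (words-unique (words-unique bool-unique n) n)

-- The bounds p < n and q < n lose nothing: 0 < q and p + q ≤ n force p < n,
-- and properness of the interval is q < n.

CO : ∀ {n} → Partition n → Set
CO {n} π =
  ∀ {p} → p < n → ∀ {q} → q < n → 0 < q → p + q ≤ n →
  ¬ Splits (interval p q) π

NoNeighbours : ∀ {m} → Partition (suc m) → Set
NoNeighbours π = ∀ k → ¬ SameBlock π (inject₁ k) (suc k)

PC⁺ : ∀ {m} → Partition (suc m) → Set
PC⁺ π = CO π × NoNeighbours π

PC : ∀ {m} → Partition (suc m) → Set
PC {m} π = CO π × NoNeighbours π × ¬ SameBlock π zero (fromℕ m)

co? : ∀ {n} → Decidable (CO {n})
co? {n} π =
  allUpTo? (λ p → allUpTo? (λ q →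
    (0 <? q) →-dec (p + q ≤? n) →-dec ¬? (splits? (interval p q) π)) n) n

pc⁺? : ∀ {m} → Decidable (PC⁺ {m})
pc⁺? π = co? π ×-dec all? λ k → ¬? (sameBlock? π (inject₁ k) (suc k))

-- σ̃ and Φ(σ, k) are specified by their sets of blocks.

HasBlocks : ∀ {n} → Partition n → (Subset n → Set) → Set
HasBlocks π P = ∀ S → IsBlock π S ⇔ P S

-- T ∷ʳ lookup T zero is T ∪ {n} if 1 ∈ T, and T otherwise.

IsTilde : ∀ {m} → Partition (suc m) → Partition (suc (suc m)) → Set
IsTilde σ σ̃ =
  HasBlocks σ̃ λ S → ∃ λ T → IsBlock σ T × S ≡ T ∷ʳ lookup T zero

-- I k j = {k₁+⋯+k_{j-1}+1, …, k₁+⋯+k_j}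

I : ∀ {l n} → Vec ℕ l → Fin l → Subset n
I k j = interval (sum (List.take (toℕ j) (Vec.toList k))) (lookup k j)

IsΦ : ∀ {l n} → Partition l → Vec ℕ l → Partition n → Set
IsΦ σ k π =
  HasBlocks π λ S → ∃ λ T → IsBlock σ T × S ≡ ⋃[ T ] (I k)

module Weighted {r ℓ} (R : CommutativeRing r ℓ) where

  open CommutativeRing R
    using (Carrier; _≈_; 0#; 1#; +-rawMonoid)
    renaming (_+_ to _⊕_; _*_ to _⊛_; -_ to ⊖_)
  open RawMonoidDefs +-rawMonoid using () renaming (sum to ∑)

  -- A weight on PC(n), PC⁺(n) or CO(n) is a function on all partitions
  -- whose values elsewhere are never used.

  Weight : Set r
  Weight = ∀ {m} → Partition (suc m) → Carrier

  record IsWeightB (a b : Weight) : Set ℓ where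
    field
      b-one   : (π : Partition 1) → b π ≈ 1#
      b-PC    : ∀ {m} (π : Partition (suc (suc m))) → PC π → b π ≈ a π
      b-tilde : ∀ {m} (σ : Partition (suc m)) (σ̃ : Partition (suc (suc m))) →
                PC σ → IsTilde σ σ̃ → b σ̃ ≈ a σ

  IsWeightC : (b c : Weight) → Set ℓ
  IsWeightC b c =
    ∀ {l m} (σ : Partition (suc l)) (k : Vec ℕ (suc l))
    (π : Partition (suc m)) →
    PC⁺ σ → VecAll.All (1 ≤_) k → Vec.sum k ≡ suc m →
    IsΦ σ k π → c π ≈ b σ

  sumOver : ∀ {p n} {P : Pred (Partition n) p} → Decidable P →
            (Partition n → Carrier) → Carrier
  sumOver {n = n} P? w =
    List.foldr _⊕_ 0# (List.map w (List.filter P? (allPartitions n)))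

  Series : Set r
  Series = ℕ → Carrier

  infix  4 _≈ˢ_
  infixl 6 _-ˢ_
  infixl 7 _*ˢ_
  infixr 8 _^ˢ_
  infixr 9 _∘ˢ_

  _≈ˢ_ : Series → Series → Set ℓ
  f ≈ˢ g = ∀ n → f n ≈ g n

  1ˢ : Series
  1ˢ zero    = 1#
  1ˢ (suc _) = 0#

  X : Series
  X 1 = 1#
  X _ = 0#

  _-ˢ_ : Series → Series → Series
  (f -ˢ g) n = f n ⊕ (⊖ g n)

  _*ˢ_ : Series → Series → Series
  (f *ˢ g) n = ∑ {suc n} λ i → f (toℕ i) ⊛ g (n ∸ toℕ i)

  _^ˢ_ : Series → ℕ → Series
  f ^ˢ zero  = 1ˢ
  f ^ˢ suc k = f *ˢ f ^ˢ k

  -- f(g(x)), meaningful when g has zero constant term: then g^k does not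
  -- contribute to the coefficient of xⁿ for k > n.

  _∘ˢ_ : Series → Series → Series
  (f ∘ˢ g) n = ∑ {suc n} λ k → f (toℕ k) ⊛ (g ^ˢ toℕ k) n

  [1-X]⁻¹ : Series
  [1-X]⁻¹ _ = 1#

  X/[1-X] : Series
  X/[1-X] = X *ˢ [1-X]⁻¹

  seriesB : Weight → Series
  seriesB b zero    = 0#
  seriesB b (suc m) = sumOver (pc⁺? {m}) b

  seriesC : Weight → Series
  seriesC c zero    = 0#
  seriesC c (suc m) = sumOver (co? {suc m}) c

  private
    module P where
      open CommutativeRing R using
        (setoid; ring; +-cong; +-congˡ; +-identityˡ; +-identityʳ;
         *-identityʳ; -‿inverseʳ)
      open import Relation.Binary.Reasoning.Setoid setoid
      open import Algebra.Properties.Ring ring using (-0#≈0#)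

      ∑-zero : ∀ n (f : Fin n → Carrier) → (∀ i → f i ≈ 0#) → ∑ f ≈ 0#
      ∑-zero zero    f h = CommutativeRing.refl R
      ∑-zero (suc n) f h = begin
        f zero ⊕ ∑ (f ∘ suc) ≈⟨ +-cong (h zero) (∑-zero n (f ∘ suc) (h ∘ suc)) ⟩
        0# ⊕ 0#              ≈⟨ +-identityˡ 0# ⟩
        0#                   ∎

      0-0 : (0# ⊕ ⊖ 0#) ⊛ 1# ≈ 0#
      0-0 = begin
        (0# ⊕ ⊖ 0#) ⊛ 1# ≈⟨ *-identityʳ _ ⟩
        0# ⊕ ⊖ 0#        ≈⟨ -‿inverseʳ 0# ⟩
        0#               ∎

      1-0 : (1# ⊕ ⊖ 0#) ⊛ 1# ≈ 1#
      1-0 = begin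
        (1# ⊕ ⊖ 0#) ⊛ 1# ≈⟨ *-identityʳ _ ⟩
        1# ⊕ ⊖ 0#        ≈⟨ +-congˡ -0#≈0# ⟩
        1# ⊕ 0#          ≈⟨ +-identityʳ 1# ⟩
        1#               ∎

      0-1 : (0# ⊕ ⊖ 1#) ⊛ 1# ≈ ⊖ 1#
      0-1 = begin
        (0# ⊕ ⊖ 1#) ⊛ 1# ≈⟨ *-identityʳ _ ⟩
        0# ⊕ ⊖ 1#        ≈⟨ +-identityˡ _ ⟩
        ⊖ 1#             ∎

      inv : (1ˢ -ˢ X) *ˢ [1-X]⁻¹ ≈ˢ 1ˢ
      inv zero = begin
        (1# ⊕ ⊖ 0#) ⊛ 1# ⊕ 0# ≈⟨ +-identityʳ _ ⟩
        (1# ⊕ ⊖ 0#) ⊛ 1#      ≈⟨ 1-0 ⟩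
        1#                    ∎
      inv (suc n) = begin
        (1# ⊕ ⊖ 0#) ⊛ 1# ⊕ ((0# ⊕ ⊖ 1#) ⊛ 1# ⊕ ∑ {n} (λ _ → (0# ⊕ ⊖ 0#) ⊛ 1#))
          ≈⟨ +-cong 1-0 (+-cong 0-1 (∑-zero n _ (λ _ → 0-0))) ⟩
        1# ⊕ (⊖ 1# ⊕ 0#)
          ≈⟨ +-congˡ (+-identityʳ _) ⟩
        1# ⊕ ⊖ 1#
          ≈⟨ -‿inverseʳ 1# ⟩
        0# ∎

  [1-X]⁻¹-inverse : (1ˢ -ˢ X) *ˢ [1-X]⁻¹ ≈ˢ 1ˢ
  [1-X]⁻¹-inverse = P.inv

{-# OPTIONS --safe #-}
module Submission where

-- A connected partition π of [n + 1] is determined by the set d of the k with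
-- k ≁ k + 1, which cuts [n + 1] into ∣ d ∣ + 1 intervals, and by the partition
-- σ ∈ PC⁺(∣ d ∣ + 1) that π induces on the set of these intervals.  Both d and σ
-- are arbitrary, so the coefficient c_{n+1} is the sum over all d ⊆ [n] of
-- b_{∣ d ∣ + 1}.  The number of d with ∣ d ∣ = l is the coefficient of x^{n+1} in
-- (x/(1-x))^{l+1}.

open import Algebra.Bundles using (CommutativeRing)
open import Defs
open import Data.Bool.Base using (Bool; true; false)
open import Data.Fin.Base as Fin using (Fin; zero; suc; toℕ; inject₁; fromℕ<)
open import Data.Fin.Properties using (toℕ<n; toℕ-fromℕ<)
open import Data.Fin.Subset using (Subset; _∈_; _∉_; ⋃; ∣_∣)
open import Data.Fin.Subset.Properties using (_∈?_; ⊆-antisym; ∉⊥; x∈p∪q⁻; x∈p∪q⁺)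
open import Data.List.Base as List using (List; []; _∷_)
open import Data.List.Membership.Propositional using (find; lose) renaming (_∈_ to _∈ˡ_)
open import Data.List.Membership.Propositional.Properties
  using (∈-map⁺; ∈-map⁻; ∈-filter⁺; ∈-filter⁻; ∈-allFin; ∈-concatMap⁺; ∈-concatMap⁻;
         ∈-cartesianProductWith⁺)
open import Data.List.Membership.Propositional.Properties.WithK using (unique∧set⇒bag)
open import Data.List.Properties using (map-∘)
open import Data.List.Relation.Binary.BagAndSetEquality using (∼bag⇒↭)
open import Data.List.Relation.Binary.Disjoint.Propositional using (Disjoint)
open import Data.List.Relation.Binary.Permutation.Propositional as ↭ using (_↭_)
open import Data.List.Relation.Unary.All as All using ([]; _∷_)
import Data.List.Relation.Unary.All.Properties as All
open import Data.List.Relation.Unary.AllPairs as AllPairs using ([]; _∷_)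
import Data.List.Relation.Unary.AllPairs.Properties as AllPairs
open import Data.List.Relation.Unary.Unique.Propositional using (Unique)
import Data.List.Relation.Unary.Unique.Propositional.Properties as Unique
open import Data.List.Relation.Unary.Any using (here; there)
open import Data.Nat.Base using (ℕ; zero; suc; _+_; _∸_; _≤_; _<_; z≤n; s≤s; s≤s⁻¹)
open import Data.Nat.ListAction using () renaming (sum to sumˡ)
import Data.Nat.Properties as ℕ
open import Data.Nat.Properties
  using (_≤?_; _<?_; ≤-refl; ≤-trans; ≤-<-trans; <-≤-trans; ≤-reflexive; <-irrefl; n<1+n;
         m<m+n; m≤n+m; m<n⇒m<1+n; n≤0⇒n≡0; ≮⇒≥; +-monoˡ-≤; +-cancelˡ-<; +-cancelʳ-≤)
open import Data.Product.Base using (_×_; _,_; ∃; ∃₂; proj₁; proj₂)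
open import Data.Sum.Base using (inj₁; inj₂)
open import Data.Vec.Base as Vec using (Vec; []; _∷_; lookup; tabulate; here; there)
open import Data.Vec.Properties
  using (∷-injective; lookup∘tabulate; tabulate-cong; tabulate∘lookup; []=⇒lookup; lookup⇒[]=)
open import Data.Vec.Relation.Unary.All as VecAll using ([]; _∷_)
open import Function.Base using (_∘_)
open import Function.Bundles using (_⇔_; mk⇔; Equivalence)
open import Relation.Binary.PropositionalEquality
  using (_≡_; _≢_; refl; sym; trans; cong; subst; subst₂)
open import Relation.Nullary.Decidable
  using (Dec; yes; no; does; dec-true; recompute; decidable-stable; proof; ¬?; _×-dec_)
open import Relation.Nullary.Reflects using (Reflects; invert)
open import Relation.Nullary.Negation using (¬_; contradiction)

open Equivalence using (to; from)

private variable l m n : ℕ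

-- Membership in preimages, intervals and indexed unions.

preimage : (Fin m → Fin n) → Subset n → Subset m
preimage g S = tabulate (lookup S ∘ g)

∈-preimage⁺ : (g : Fin m → Fin n) {S : Subset n} {i : Fin m} → g i ∈ S → i ∈ preimage g S
∈-preimage⁺ g {S} {i} h = lookup⇒[]= i _ (trans (lookup∘tabulate _ i) ([]=⇒lookup h))

∈-preimage⁻ : (g : Fin m → Fin n) {S : Subset n} {i : Fin m} → i ∈ preimage g S → g i ∈ S
∈-preimage⁻ g {S} {i} h =
  lookup⇒[]= (g i) S (trans (sym (lookup∘tabulate (lookup S ∘ g) i)) ([]=⇒lookup h))

subset-ext : {S T : Subset n} → (∀ i → i ∈ S ⇔ i ∈ T) → S ≡ T
subset-ext h = ⊆-antisym (to (h _)) (from (h _))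

∈-tabulate⁺ : {P : Fin n → Set} (P? : ∀ i → Dec (P i)) → ∀ {i} → P i → i ∈ tabulate (does ∘ P?)
∈-tabulate⁺ P? {i} h =
  lookup⇒[]= i _ (trans (lookup∘tabulate (does ∘ P?) i) (dec-true (P? i) h))

∈-tabulate⁻ : {P : Fin n → Set} (P? : ∀ i → Dec (P i)) → ∀ {i} → i ∈ tabulate (does ∘ P?) → P i
∈-tabulate⁻ P? {i} h = invert (subst (Reflects _)
  (trans (sym (lookup∘tabulate (does ∘ P?) i)) ([]=⇒lookup h)) (proof (P? i)))

module _ (p q : ℕ) where

  inRange? : (i : Fin n) → Dec (p ≤ toℕ i × toℕ i < p + q)
  inRange? i = (p ≤? toℕ i) ×-dec (toℕ i <? p + q)

  ∈-interval⁺ : {i : Fin n} → p ≤ toℕ i → toℕ i < p + q → i ∈ interval p q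
  ∈-interval⁺ h₁ h₂ = ∈-tabulate⁺ inRange? (h₁ , h₂)

  ∈-interval⁻ : {i : Fin n} → i ∈ interval p q → p ≤ toℕ i × toℕ i < p + q
  ∈-interval⁻ = ∈-tabulate⁻ inRange?

∈-⋃⁺ : ∀ {x : Fin n} {S} Ss → S ∈ˡ Ss → x ∈ S → x ∈ ⋃ Ss
∈-⋃⁺ (S ∷ Ss) (here refl) x∈ = x∈p∪q⁺ (inj₁ x∈)
∈-⋃⁺ (S ∷ Ss) (there S∈) x∈ = x∈p∪q⁺ (inj₂ (∈-⋃⁺ Ss S∈ x∈))

∈-⋃⁻ : ∀ {x : Fin n} Ss → x ∈ ⋃ Ss → ∃ λ S → S ∈ˡ Ss × x ∈ S
∈-⋃⁻ [] x∈ = contradiction x∈ ∉⊥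
∈-⋃⁻ (S ∷ Ss) x∈ with x∈p∪q⁻ S (⋃ Ss) x∈
... | inj₁ h = S , here refl , h
... | inj₂ h with T , T∈ , x∈T ← ∈-⋃⁻ Ss h = T , there T∈ , x∈T

∈-⋃[]⁺ : ∀ (T : Subset m) (F : Fin m → Subset n) {j x} → j ∈ T → x ∈ F j → x ∈ ⋃[ T ] F
∈-⋃[]⁺ T F {j} j∈ x∈ =
  ∈-⋃⁺ (List.map F (List.filter (_∈? T) (List.allFin _))) (∈-map⁺ F (∈-filter⁺ (_∈? T) (∈-allFin j) j∈)) x∈

∈-⋃[]⁻ : ∀ (T : Subset m) (F : Fin m → Subset n) {x} →
         x ∈ ⋃[ T ] F → ∃ λ j → j ∈ T × x ∈ F j
∈-⋃[]⁻ T F h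
  with S , S∈ , x∈ ← ∈-⋃⁻ (List.map F (List.filter (_∈? T) (List.allFin _))) h
  with j , j∈ , refl ← ∈-map⁻ F S∈ = j , proj₂ (∈-filter⁻ (_∈? T) {xs = List.allFin _} j∈) , x∈

-- Turns the unions of intervals that specify `IsΦ` into preimages, since the intervals are the
-- fibres of the map from elements to parts.
⋃[]-fibres : (g : Fin n → Fin m) {F : Fin m → Subset n} →
             (∀ i j → i ∈ F j ⇔ g i ≡ j) → ∀ T → ⋃[ T ] F ≡ preimage g T
⋃[]-fibres g {F} fib T = subset-ext λ i → mk⇔
  (λ h → let j , j∈ , i∈ = ∈-⋃[]⁻ T F h in
    ∈-preimage⁺ g (subst (_∈ T) (sym (to (fib i j) i∈)) j∈))
  (λ h → ∈-⋃[]⁺ T F (∈-preimage⁻ g h) (from (fib i (g i)) refl))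

-- Partitions as equivalence relations, and their pullbacks.

infix 4 _∼[_]_

_∼[_]_ : Fin n → Partition n → Fin n → Set
i ∼[ π ] j = j ∈ blockOf π i

-- The irrelevant field can be recovered because validity of a table is decidable.
blockTable-valid : (π : Partition n) → IsBlockTable (table π)
blockTable-valid (partition t p) = recompute (isBlockTable? t) p

∼⇒block≡ : (π : Partition n) → ∀ {i j} → i ∼[ π ] j → blockOf π j ≡ blockOf π i
∼⇒block≡ π = proj₂ (blockTable-valid π) _ _

∼-refl : (π : Partition n) → ∀ {i} → i ∼[ π ] i
∼-refl π = proj₁ (blockTable-valid π) _

∼-sym : (π : Partition n) → ∀ {i j} → i ∼[ π ] j → j ∼[ π ] i
∼-sym π i∼j = subst (_ ∈_) (sym (∼⇒block≡ π i∼j)) (∼-refl π)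

∼-trans : (π : Partition n) → ∀ {i j k} → i ∼[ π ] j → j ∼[ π ] k → i ∼[ π ] k
∼-trans π i∼j j∼k = subst (_ ∈_) (∼⇒block≡ π i∼j) j∼k

sameBlock⇔∼ : (π : Partition n) → ∀ {i j} → SameBlock π i j ⇔ i ∼[ π ] j
sameBlock⇔∼ π = mk⇔
  (λ (k , i∈ , j∈) → ∼-trans π (∼-sym π i∈) j∈)
  (λ i∼j → _ , ∼-refl π , i∼j)

partition-ext : (π ρ : Partition n) → (∀ i j → i ∼[ π ] j ⇔ i ∼[ ρ ] j) → π ≡ ρ
partition-ext π@(partition t _) ρ@(partition u _) h =
  go (trans (sym (tabulate∘lookup t))
       (trans (tabulate-cong λ i → subset-ext (h i)) (tabulate∘lookup u)))
  where
  go : t ≡ u → π ≡ ρ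
  go refl = refl

-- Both directions of the bijection are pullbacks: `Φ d` along the map from elements to parts, and
-- its inverse `restrict d` along the map from parts to their first elements.
pullback : (Fin m → Fin n) → Partition n → Partition m
pullback g π = partition (tabulate block) (contains , agrees)
  where
  block = λ i → preimage g (blockOf π (g i))

  contains : ∀ i → i ∈ lookup (tabulate block) i
  contains i rewrite lookup∘tabulate block i = ∈-preimage⁺ g (∼-refl π)

  agrees : ∀ i j → j ∈ lookup (tabulate block) i →
           lookup (tabulate block) j ≡ lookup (tabulate block) i
  agrees i j rewrite lookup∘tabulate block i | lookup∘tabulate block j =
    cong (preimage g) ∘ ∼⇒block≡ π ∘ ∈-preimage⁻ g

blockOf-pullback : (g : Fin m → Fin n) (π : Partition n) →
                   ∀ i → blockOf (pullback g π) i ≡ preimage g (blockOf π (g i))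
blockOf-pullback g π = lookup∘tabulate _

∼-pullback : (g : Fin m → Fin n) (π : Partition n) →
             ∀ {i j} → i ∼[ pullback g π ] j ⇔ g i ∼[ π ] g j
∼-pullback g π {i} rewrite blockOf-pullback g π i = mk⇔ (∈-preimage⁻ g) (∈-preimage⁺ g)

-- Condition (a) in terms of convex closed sets.

Closed : Partition n → Subset n → Set
Closed π S = ∀ {i j} → i ∼[ π ] j → i ∈ S → j ∈ S

-- Blocks are indexed by their elements, so a closed `S` is the union of the blocks indexed by `S`
-- itself.
splits⇔closed : (π : Partition n) (S : Subset n) → Splits S π ⇔ Closed π S
splits⇔closed π S = mk⇔
  (λ { (T , refl) i∼j i∈ → let k , k∈ , i∈k = ∈-⋃[]⁻ T (blockOf π) i∈ in
       ∈-⋃[]⁺ T (blockOf π) k∈ (∼-trans π i∈k i∼j) })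
  (λ closed → S , subset-ext λ i → mk⇔
    (λ i∈ → ∈-⋃[]⁺ S (blockOf π) i∈ (∼-refl π))
    (λ i∈ → let k , k∈ , k∼i = ∈-⋃[]⁻ S (blockOf π) i∈ in closed k∼i k∈))

-- Intervals without endpoints: in this form, preimages under monotone maps are again convex with no
-- computation.
Convex : Subset n → Set
Convex S = ∀ {i j k} → i Fin.≤ j → j Fin.≤ k → i ∈ S → k ∈ S → j ∈ S

interval-convex : ∀ p q → Convex (interval {n} p q)
interval-convex p q i≤j j≤k i∈ k∈ = ∈-interval⁺ p q
  (≤-trans (proj₁ (∈-interval⁻ p q i∈)) i≤j)
  (≤-<-trans j≤k (proj₂ (∈-interval⁻ p q k∈)))

drop-there : ∀ {b : Bool} {S : Subset n} {i} → suc i ∈ b ∷ S → i ∈ S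
drop-there (there h) = h

-- Induction on `n`. The only delicate case is a set that contains the first element and has a
-- nonempty tail: convexity then forces the interval of the tail to start at 0.
convex⇒interval : (S : Subset n) → Convex S →
                  ∃₂ λ p q → p + q ≤ n × (∀ i → i ∈ S ⇔ (p ≤ toℕ i × toℕ i < p + q))
convex⇒interval [] _ = 0 , 0 , z≤n , λ ()
convex⇒interval {suc n} (b ∷ S) convex
  with p , q , p+q≤n , S⇔ ← convex⇒interval S
         (λ i≤j j≤k i∈ k∈ → drop-there (convex (s≤s i≤j) (s≤s j≤k) (there i∈) (there k∈)))
  with b | q
... | false | q = suc p , q , s≤s p+q≤n , λ
  { zero    → mk⇔ (λ ()) (λ ())
  ; (suc i) → mk⇔ (λ { (there h) → let u , v = to (S⇔ i) h in s≤s u , s≤s v })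
                  (λ (u , v) → there (from (S⇔ i) (s≤s⁻¹ u , s≤s⁻¹ v))) }
... | true | zero = 0 , 1 , s≤s z≤n , λ
  { zero    → mk⇔ (λ _ → z≤n , s≤s z≤n) (λ _ → here)
  ; (suc i) → mk⇔
      (λ { (there h) → let u , v = to (S⇔ i) h in
           contradiction (≤-<-trans u (subst (toℕ i <_) (ℕ.+-identityʳ p) v)) (<-irrefl refl) })
      (λ { (_ , s≤s ()) }) }
... | true | suc q = 0 , suc (suc q) , subst (λ p → suc (p + suc q) ≤ suc n) p≡0 (s≤s p+q≤n) , λ
  { zero    → mk⇔ (λ _ → z≤n , s≤s z≤n) (λ _ → here)
  ; (suc i) → mk⇔
      (λ { (there h) → z≤n , s≤s (subst (λ p → toℕ i < p + suc q) p≡0 (proj₂ (to (S⇔ i) h))) })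
      (λ (_ , v) → there (from (S⇔ i)
        (subst (_≤ toℕ i) (sym p≡0) z≤n , subst (λ p → toℕ i < p + suc q) (sym p≡0) (s≤s⁻¹ v)))) }
  where
  p<n : p < n
  p<n = <-≤-trans (m<m+n p (s≤s z≤n)) p+q≤n

  -- `last` is position `p` of the tail, where its interval starts, and `first` is position 0 of the
  -- tail. The latter lies between the first element of the whole set and `last`, so it belongs to
  -- `S`, whence `p ≤ 0`.
  first last : Fin n
  first = fromℕ< (≤-<-trans z≤n p<n)
  last  = fromℕ< p<n

  last∈ : last ∈ S
  last∈ = from (S⇔ last)
    ( subst (p ≤_) (sym (toℕ-fromℕ< p<n)) ≤-refl
    , subst (_< p + suc q) (sym (toℕ-fromℕ< p<n)) (m<m+n p (s≤s z≤n)))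

  first∈ : first ∈ S
  first∈ = drop-there (convex {i = zero} z≤n
    (s≤s (subst (_≤ toℕ last) (sym (toℕ-fromℕ< _)) z≤n)) here (there last∈))

  p≡0 : p ≡ 0
  p≡0 = n≤0⇒n≡0 (subst (p ≤_) (toℕ-fromℕ< _) (proj₁ (to (S⇔ first) first∈)))

-- Condition (a) freed of endpoints and bounds, so that it can be carried along monotone maps.
Connected : Partition n → Set
Connected {n} π = (S : Subset n) → Convex S → Closed π S → ∀ {i} → i ∈ S → ∀ j → j ∈ S

CO⇒Connected : (π : Partition n) → CO π → Connected π
CO⇒Connected {n} π co S convex closed {i} i∈S j
  with p , q , p+q≤n , S⇔ ← convex⇒interval S convex
  with q <? n
... | yes q<n = contradiction splits (co p<n q<n 0<q p+q≤n)
  where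
  S≡interval : S ≡ interval p q
  S≡interval = subset-ext λ i → mk⇔
    (λ h → let u , v = to (S⇔ i) h in ∈-interval⁺ p q u v)
    (λ h → from (S⇔ i) (∈-interval⁻ p q h))

  splits : Splits (interval p q) π
  splits = subst (λ S → Splits S π) S≡interval (from (splits⇔closed π S) closed)

  p<n : p < n
  p<n = ≤-<-trans (proj₁ (to (S⇔ i) i∈S)) (toℕ<n i)

  0<q : 0 < q
  0<q = +-cancelˡ-< p 0 q (subst (_< p + q) (sym (ℕ.+-identityʳ p))
    (≤-<-trans (proj₁ (to (S⇔ i) i∈S)) (proj₂ (to (S⇔ i) i∈S))))
-- From `n ≤ q` and `p + q ≤ n` follows `p ≤ 0`, so the interval is everything.
... | no q≮n = from (S⇔ j)
  ( ≤-trans (+-cancelʳ-≤ q p 0 (≤-trans p+q≤n (≮⇒≥ q≮n))) z≤n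
  , <-≤-trans (toℕ<n j) (≤-trans (≮⇒≥ q≮n) (m≤n+m q p)))

-- A splitting interval would contain every position. Containing position 0 gives `p ≤ 0`;
-- containing position `q`, which exists because `q < n`, then gives `q < q`.
Connected⇒CO : (π : Partition n) → Connected π → CO π
Connected⇒CO {n} π connected {p} p<n {q} q<n 0<q p+q≤n splits =
  <-irrefl (toℕ-fromℕ< q<n) (<-≤-trans (proj₂ (∈-interval⁻ p q (full (fromℕ< q<n)))) (+-monoˡ-≤ q p≤0))
  where
  p∈ : fromℕ< p<n ∈ interval p q
  p∈ = ∈-interval⁺ p q (≤-reflexive (sym (toℕ-fromℕ< p<n)))
    (subst (_< p + q) (sym (toℕ-fromℕ< p<n)) (m<m+n p 0<q))

  full : ∀ j → j ∈ interval p q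
  full = connected (interval p q) (interval-convex p q) (to (splits⇔closed π _) splits) p∈

  p≤0 : p ≤ 0
  p≤0 = subst (p ≤_) (toℕ-fromℕ< (≤-<-trans z≤n p<n))
    (proj₁ (∈-interval⁻ p q (full (fromℕ< (≤-<-trans z≤n p<n)))))

-- Pullbacks along maps that have an inverse up to blocks.

Monotone : (Fin m → Fin n) → Set
Monotone g = ∀ {i j} → i Fin.≤ j → g i Fin.≤ g j

module _ (f : Fin m → Fin n) (g : Fin n → Fin m) (π : Partition n)
         (fg∼ : ∀ i → f (g i) ∼[ π ] i) where

  -- Moving both elements by `f ∘ g` stays within their blocks. Taking `f` and `g` to be `segment d`
  -- and `leader d`, in either order, gives the two inverse laws for `Φ` and `restrict`.
  pullback-pullback : pullback g (pullback f π) ≡ π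
  pullback-pullback = partition-ext _ π λ i j → mk⇔
    (λ h → ∼-trans π (∼-sym π (fg∼ i)) (∼-trans π
      (to (∼-pullback f π) (to (∼-pullback g (pullback f π)) h)) (fg∼ j)))
    (λ h → from (∼-pullback g (pullback f π)) (from (∼-pullback f π)
      (∼-trans π (fg∼ i) (∼-trans π h (∼-sym π (fg∼ j))))))

  -- A convex closed set pulls back along f to a convex closed set, and
  -- membership in a closed set can be tested on the image of f.
  pullback-reflects-Connected : Monotone f → Connected (pullback f π) → Connected π
  pullback-reflects-Connected mono connected S convex closed {i} i∈S j =
    closed (fg∼ j) (∈-preimage⁻ f (connected (preimage f S)
      (λ i≤j j≤k i∈ k∈ → ∈-preimage⁺ f
        (convex (mono i≤j) (mono j≤k) (∈-preimage⁻ f i∈) (∈-preimage⁻ f k∈)))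
      (λ i∼j i∈ → ∈-preimage⁺ f (closed (to (∼-pullback f π) i∼j) (∈-preimage⁻ f i∈)))
      (∈-preimage⁺ f (closed (∼-sym π (fg∼ i)) i∈S))
      (g j)))

-- Compositions encoded as sets of breaks.

-- A composition of n + 1 is given by the set d of the k : Fin n at which one
-- part ends and the next one starts.  Then segment d i is the part containing
-- i and leader d j is the first element of the part j.

segment : (d : Subset n) → Fin (suc n) → Fin (suc ∣ d ∣)
segment []          _       = zero
segment (_     ∷ d) zero    = zero
segment (true  ∷ d) (suc i) = suc (segment d i)
segment (false ∷ d) (suc i) = segment d i

leader : (d : Subset n) → Fin (suc ∣ d ∣) → Fin (suc n)
leader d           zero    = zero
leader (true  ∷ d) (suc j) = suc (leader d j)
leader (false ∷ d) (suc j) = suc (leader d (suc j))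

sizes : (d : Subset n) → Vec ℕ (suc ∣ d ∣)
sizes []          = 1 ∷ []
sizes (true  ∷ d) = 1 ∷ sizes d
sizes (false ∷ d) = suc (Vec.head (sizes d)) ∷ Vec.tail (sizes d)

segment-zero : (d : Subset n) → segment d zero ≡ zero
segment-zero []      = refl
segment-zero (_ ∷ d) = refl

segment-leader : (d : Subset n) → ∀ j → segment d (leader d j) ≡ j
segment-leader d           zero    = segment-zero d
segment-leader (true  ∷ d) (suc j) = cong suc (segment-leader d j)
segment-leader (false ∷ d) (suc j) = segment-leader d (suc j)

segment-monotone : (d : Subset n) → Monotone (segment d)
segment-monotone []          _                              = z≤n
segment-monotone (b     ∷ d) {zero}  {j}     _         = z≤n
segment-monotone (true  ∷ d) {suc i} {suc j} (s≤s i≤j) = s≤s (segment-monotone d i≤j)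
segment-monotone (false ∷ d) {suc i} {suc j} (s≤s i≤j) = segment-monotone d i≤j

leader-monotone : (d : Subset n) → Monotone (leader d)
leader-monotone d           {zero}          _         = z≤n
leader-monotone (true  ∷ d) {suc i} {suc j} (s≤s i≤j) = s≤s (leader-monotone d i≤j)
leader-monotone (false ∷ d) {suc i} {suc j} i≤j       = s≤s (leader-monotone d i≤j)

segment-∉ : (d : Subset n) → ∀ k → k ∉ d → segment d (inject₁ k) ≡ segment d (suc k)
segment-∉ (true  ∷ d) zero    k∉ = contradiction here k∉
segment-∉ (false ∷ d) zero    k∉ = sym (segment-zero d)
segment-∉ (true  ∷ d) (suc k) k∉ = cong suc (segment-∉ d k (k∉ ∘ there))
segment-∉ (false ∷ d) (suc k) k∉ = segment-∉ d k (k∉ ∘ there)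

SegmentsMeetAt : (d : Subset n) → Fin n → Fin ∣ d ∣ → Set
SegmentsMeetAt d k j = segment d (inject₁ k) ≡ inject₁ j × segment d (suc k) ≡ suc j

-- Turns a break into a pair of neighbouring parts, to which `NoNeighbours` of the partition of the
-- parts applies.
segment-∈ : (d : Subset n) → ∀ k → k ∈ d → ∃ (SegmentsMeetAt d k)
segment-∈ (true  ∷ d) zero    here       = zero , refl , cong suc (segment-zero d)
segment-∈ (true  ∷ d) (suc k) (there k∈) =
  let j , e , e′ = segment-∈ d k k∈ in suc j , cong suc e , cong suc e′
segment-∈ (false ∷ d) (suc k) (there k∈) = segment-∈ d k k∈

-- The other direction: a pair of neighbouring parts yields a break, which proves `NoNeighbours` for
-- the induced partition.
segments-meet : (d : Subset n) → ∀ j → ∃ λ k → k ∈ d × SegmentsMeetAt d k j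
segments-meet (true  ∷ d) zero    = zero , here , refl , cong suc (segment-zero d)
segments-meet (true  ∷ d) (suc j) =
  let k , k∈ , e , e′ = segments-meet d j in suc k , there k∈ , cong suc e , cong suc e′
segments-meet (false ∷ d) j       =
  let k , k∈ , e , e′ = segments-meet d j in suc k , there k∈ , e , e′

sizes-positive : (d : Subset n) → VecAll.All (1 ≤_) (sizes d)
sizes-positive []          = s≤s z≤n ∷ []
sizes-positive (true  ∷ d) = s≤s z≤n ∷ sizes-positive d
sizes-positive (false ∷ d) with sizes d | sizes-positive d
... | _ ∷ _ | _ ∷ ps = s≤s z≤n ∷ ps

sum-sizes : (d : Subset n) → Vec.sum (sizes d) ≡ suc n
sum-sizes []          = refl
sum-sizes (true  ∷ d) = cong suc (sum-sizes d)
sum-sizes (false ∷ d) with sizes d | sum-sizes d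
... | _ ∷ _ | e = cong suc e

-- The left endpoint that occurs in the definition of `I`.
start : Vec ℕ l → Fin l → ℕ
start k j = sumˡ (List.take (toℕ j) (Vec.toList k))

-- Induction on `d`. A new first element shifts all others by one; it either forms a part of size 1
-- or enlarges the first part by 1, and in both cases the starts of the later old parts shift by one
-- as well.
segment⇔range : (d : Subset n) → ∀ i j →
  (start (sizes d) j ≤ toℕ i × toℕ i < start (sizes d) j + lookup (sizes d) j) ⇔ segment d i ≡ j
segment⇔range []          zero    zero    = mk⇔ (λ _ → refl) (λ _ → z≤n , s≤s z≤n)
segment⇔range (true  ∷ d) zero    zero    = mk⇔ (λ _ → refl) (λ _ → z≤n , s≤s z≤n)
segment⇔range (true  ∷ d) zero    (suc j) = mk⇔ (λ ()) (λ ())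
segment⇔range (true  ∷ d) (suc i) zero    = mk⇔ (λ { (_ , s≤s ()) }) (λ ())
segment⇔range (true  ∷ d) (suc i) (suc j) = mk⇔
  (λ (u , v) → cong suc (to (segment⇔range d i j) (s≤s⁻¹ u , s≤s⁻¹ v)))
  (λ { refl → let u , v = from (segment⇔range d i j) refl in s≤s u , s≤s v })
segment⇔range (false ∷ d) zero    zero    = mk⇔ (λ _ → refl) (λ _ → z≤n , s≤s z≤n)
segment⇔range (false ∷ d) zero    (suc j) = mk⇔ (λ ()) (λ ())
segment⇔range (false ∷ d) (suc i) zero    with sizes d | segment⇔range d i zero
... | _ ∷ _ | ih = mk⇔
  (λ (_ , v) → to ih (z≤n , s≤s⁻¹ v)) (λ e → z≤n , s≤s (proj₂ (from ih e)))
segment⇔range (false ∷ d) (suc i) (suc j) with sizes d | segment⇔range d i (suc j)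
... | _ ∷ _ | ih = mk⇔
  (λ (u , v) → to ih (s≤s⁻¹ u , s≤s⁻¹ v))
  (λ e → let u , v = from ih e in s≤s u , s≤s v)

∈-I : (d : Subset n) → ∀ i j → i ∈ I (sizes d) j ⇔ segment d i ≡ j
∈-I d i j = mk⇔
  (to (segment⇔range d i j) ∘ ∈-interval⁻ (start (sizes d) j) _)
  (λ e → let u , v = from (segment⇔range d i j) e in ∈-interval⁺ (start (sizes d) j) _ u v)

-- The map Φ and its inverse.

Φ : (d : Subset n) → Partition (suc ∣ d ∣) → Partition (suc n)
Φ d = pullback (segment d)

isΦ : (d : Subset n) (σ : Partition (suc ∣ d ∣)) → IsΦ σ (sizes d) (Φ d σ)
isΦ d σ S = mk⇔
  (λ { (i , refl) → blockOf σ (segment d i) , (segment d i , refl) ,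
       trans (blockOf-pullback (segment d) σ i) (sym (union (blockOf σ (segment d i)))) })
  -- The block of `σ` at `j` comes from any element of the part `j`; its leader is one.
  (λ { (_ , (j , refl) , refl) → leader d j , trans (union (blockOf σ j)) (sym (trans
       (blockOf-pullback (segment d) σ (leader d j))
       (cong (preimage (segment d) ∘ blockOf σ) (segment-leader d j)))) })
  where
  union : ∀ T → ⋃[ T ] (I (sizes d)) ≡ preimage (segment d) T
  union T = ⋃[]-fibres (segment d) (∈-I d) T

-- Walking from the leader of a part to `i` crosses no break, so consecutive elements on the way are
-- related. The induction removes the first element by pulling back along `suc`.
leader-segment : (d : Subset n) (π : Partition (suc n)) →
                 (∀ k → k ∉ d → inject₁ k ∼[ π ] suc k) → ∀ i → leader d (segment d i) ∼[ π ] i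
leader-segment []          π h zero    = ∼-refl π
leader-segment (_     ∷ d) π h zero    = ∼-refl π
leader-segment (true  ∷ d) π h (suc i) =
  to (∼-pullback suc π) (leader-segment d (pullback suc π)
    (λ k k∉ → from (∼-pullback suc π) (h (suc k) (k∉ ∘ drop-there))) i)
leader-segment (false ∷ d) π h (suc i)
  with segment d i | leader-segment d (pullback suc π)
    (λ k k∉ → from (∼-pullback suc π) (h (suc k) (k∉ ∘ drop-there))) i
-- Here the added first element becomes the leader of the part of `i`; the absent break after it
-- links it to the old leader.
... | zero  | ih = ∼-trans π (h zero λ ()) (to (∼-pullback suc π) ih)
... | suc j | ih = to (∼-pullback suc π) ih

-- The partition induced on the parts, each part being represented by its first element.
restrict : (d : Subset n) → Partition (suc n) → Partition (suc ∣ d ∣)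
restrict d = pullback (leader d)

module _ (d : Subset n) (σ : Partition (suc ∣ d ∣)) where

  segment-leader-∼ : ∀ j → segment d (leader d j) ∼[ σ ] j
  segment-leader-∼ j = subst (_∼[ σ ] j) (sym (segment-leader d j)) (∼-refl σ)

  restrict-Φ : restrict d (Φ d σ) ≡ σ
  restrict-Φ = pullback-pullback (segment d) (leader d) σ segment-leader-∼

  Φ-∉ : ∀ k → k ∉ d → inject₁ k ∼[ Φ d σ ] suc k
  Φ-∉ k k∉ = from (∼-pullback (segment d) σ)
    (subst (segment d (inject₁ k) ∼[ σ ]_) (segment-∉ d k k∉) (∼-refl σ))

  -- By `restrict-Φ`, `σ` is itself the pullback of `Φ d σ` along `leader d`, so connectedness is
  -- reflected. In the converse `segment d` and `leader d` exchange roles.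
  Φ-CO : CO σ → CO (Φ d σ)
  Φ-CO co = Connected⇒CO (Φ d σ) (pullback-reflects-Connected (leader d) (segment d) (Φ d σ)
    (leader-segment d (Φ d σ) Φ-∉) (leader-monotone d)
    (subst Connected (sym restrict-Φ) (CO⇒Connected σ co)))

  Φ-reflects-CO : CO (Φ d σ) → CO σ
  Φ-reflects-CO co = Connected⇒CO σ (pullback-reflects-Connected (segment d) (leader d) σ
    segment-leader-∼ (segment-monotone d) (CO⇒Connected (Φ d σ) co))

Φ-injective : (d : Subset n) {σ τ : Partition (suc ∣ d ∣)} → Φ d σ ≡ Φ d τ → σ ≡ τ
Φ-injective d {σ} {τ} e =
  trans (sym (restrict-Φ d σ)) (trans (cong (restrict d) e) (restrict-Φ d τ))

break? : (π : Partition (suc n)) (k : Fin n) → Dec (¬ inject₁ k ∼[ π ] suc k)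
break? π k = ¬? (suc k ∈? blockOf π (inject₁ k))

breaks : Partition (suc n) → Subset n
breaks π = tabulate (does ∘ break? π)

-- No break arises inside a part, and none of `d` is lost, since related elements across it would
-- put two neighbouring parts into one block of `σ`.
breaks-Φ : (d : Subset n) (σ : Partition (suc ∣ d ∣)) → NoNeighbours σ → breaks (Φ d σ) ≡ d
breaks-Φ d σ noNeighbours = subset-ext λ k → mk⇔
  (λ k∈ → decidable-stable (k ∈? d) λ k∉ → ∈-tabulate⁻ (break? (Φ d σ)) k∈ (Φ-∉ d σ k k∉))
  (λ k∈ → ∈-tabulate⁺ (break? (Φ d σ)) λ k∼ →
    let j , e , e′ = segment-∈ d k k∈ in
    noNeighbours j (from (sameBlock⇔∼ σ)
      (subst₂ (_∼[ σ ]_) e e′ (to (∼-pullback (segment d) σ) k∼))))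

-- Outside `breaks π` neighbours are related, so every element is related to its leader.
Φ-restrict-breaks : (π : Partition (suc n)) → Φ (breaks π) (restrict (breaks π) π) ≡ π
Φ-restrict-breaks π = pullback-pullback (leader d) (segment d) π
  (leader-segment d π λ k k∉ →
    decidable-stable (suc k ∈? blockOf π (inject₁ k)) (k∉ ∘ ∈-tabulate⁺ (break? π)))
  where d = breaks π

-- Condition (a) is reflected by `Φ`. For (b), two neighbouring parts in one block would make `π`
-- relate the two elements at the break between them.
restrict-breaks-PC⁺ : (π : Partition (suc n)) → CO π → PC⁺ (restrict (breaks π) π)
restrict-breaks-PC⁺ π co =
    Φ-reflects-CO d σ (subst CO (sym (Φ-restrict-breaks π)) co)
  , λ j same →
      let k , k∈ , e , e′ = segments-meet d j in
      ∈-tabulate⁻ (break? π) k∈ (subst (inject₁ k ∼[_] suc k) (Φ-restrict-breaks π)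
        (from (∼-pullback (segment d) σ)
          (subst₂ (_∼[ σ ]_) (sym e) (sym e′) (to (sameBlock⇔∼ σ) same))))
  where
  d = breaks π
  σ = restrict d π

-- The bijection as a permutation of lists.

allSubsets : ∀ n → List (Subset n)
allSubsets = words (true ∷ false ∷ [])

allSubsets-complete : (S : Subset n) → S ∈ˡ allSubsets n
allSubsets-complete []          = here refl
allSubsets-complete (true  ∷ S) =
  ∈-cartesianProductWith⁺ _∷_ {xs = true ∷ false ∷ []} (here refl) (allSubsets-complete S)
allSubsets-complete (false ∷ S) =
  ∈-cartesianProductWith⁺ _∷_ {xs = true ∷ false ∷ []} (there (here refl)) (allSubsets-complete S)

allSubsets-unique : ∀ n → Unique (allSubsets n)
allSubsets-unique zero    = [] ∷ []
allSubsets-unique (suc n) = Unique.cartesianProductWith⁺ _∷_ ∷-injective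
  (((λ ()) ∷ []) ∷ [] ∷ []) (allSubsets-unique n)

partitionsPC⁺ : ∀ m → List (Partition (suc m))
partitionsPC⁺ m = List.filter pc⁺? (allPartitions (suc m))

partitionsCO : ∀ m → List (Partition (suc m))
partitionsCO m = List.filter co? (allPartitions (suc m))

imageΦ : Subset n → List (Partition (suc n))
imageΦ d = List.map (Φ d) (partitionsPC⁺ ∣ d ∣)

imagesΦ : ∀ m → List (Partition (suc m))
imagesΦ m = List.concatMap imageΦ (allSubsets m)

∈-partitionsPC⁺ : (σ : Partition (suc m)) → σ ∈ˡ partitionsPC⁺ m ⇔ PC⁺ σ
∈-partitionsPC⁺ σ = mk⇔
  (λ σ∈ → proj₂ (∈-filter⁻ pc⁺? {xs = allPartitions _} σ∈))
  (∈-filter⁺ pc⁺? (allPartitions-complete σ))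

-- Since `d` is recovered from `π`, the images for different `d` are disjoint.
∈-imageΦ⇒breaks : (d : Subset n) {π : Partition (suc n)} → π ∈ˡ imageΦ d → breaks π ≡ d
∈-imageΦ⇒breaks d π∈ with σ , σ∈ , refl ← ∈-map⁻ (Φ d) π∈ =
  breaks-Φ d σ (proj₂ (to (∈-partitionsPC⁺ σ) σ∈))

imagesΦ-unique : ∀ m → Unique (imagesΦ m)
imagesΦ-unique m = Unique.concat⁺
  (All.map⁺ (All.universal (λ d → Unique.map⁺ (Φ-injective d)
    (Unique.filter⁺ pc⁺? (allPartitions-unique (suc ∣ d ∣)))) (allSubsets m)))
  (AllPairs.map⁺ (AllPairs.map disjoint (allSubsets-unique m)))
  where
  disjoint : {d e : Subset m} → d ≢ e → Disjoint (imageΦ d) (imageΦ e)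
  disjoint d≢e (π∈d , π∈e) =
    d≢e (trans (sym (∈-imageΦ⇒breaks _ π∈d)) (∈-imageΦ⇒breaks _ π∈e))

∈-imagesΦ : (π : Partition (suc m)) → π ∈ˡ imagesΦ m ⇔ CO π
∈-imagesΦ {m} π = mk⇔ sound complete
  where
  sound : π ∈ˡ imagesΦ m → CO π
  sound π∈
    with d , _ , π∈d ← find (∈-concatMap⁻ imageΦ {xs = allSubsets m} π∈)
    with σ , σ∈ , refl ← ∈-map⁻ (Φ d) π∈d = Φ-CO d σ (proj₁ (to (∈-partitionsPC⁺ σ) σ∈))

  complete : CO π → π ∈ˡ imagesΦ m
  complete co = ∈-concatMap⁺ imageΦ (lose (allSubsets-complete (breaks π))
    (subst (_∈ˡ imageΦ (breaks π)) (Φ-restrict-breaks π)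
      (∈-map⁺ (Φ (breaks π)) (from (∈-partitionsPC⁺ (restrict (breaks π) π)) (restrict-breaks-PC⁺ π co)))))

-- Two lists without repetitions and with the same members are permutations of each other, which is
-- what reindexing a sum requires.
partitionsCO↭imagesΦ : ∀ m → partitionsCO m ↭ imagesΦ m
partitionsCO↭imagesΦ m = ∼bag⇒↭ (unique∧set⇒bag
  (Unique.filter⁺ co? (allPartitions-unique (suc m))) (imagesΦ-unique m) (λ {π} → mk⇔
    (λ π∈ → from (∈-imagesΦ π) (proj₂ (∈-filter⁻ co? {xs = allPartitions (suc m)} π∈)))
    (λ π∈ → ∈-filter⁺ co? (allPartitions-complete π) (to (∈-imagesΦ π) π∈))))

-- Sums over lists and coefficients of power series.

module _ {r ℓ} (R : CommutativeRing r ℓ) where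

  open Weighted R
  open CommutativeRing R
    using (Carrier; _≈_; _*_; 0#; 1#; reflexive; setoid; semiring; +-commutativeSemigroup;
           +-cong; +-congˡ; +-congʳ; *-congˡ; *-congʳ; +-assoc; +-comm; +-identityˡ; +-identityʳ;
           *-identityˡ; *-identityʳ; zeroˡ; zeroʳ; distribˡ)
    renaming (_+_ to _⊕_; refl to ≈-refl; sym to ≈-sym; trans to ≈-trans)
  open import Algebra.Properties.Semiring.Sum semiring
    using (∑-distrib-+; sum-cong-≋; sum-replicate-zero) renaming (sum to ∑)
  open import Algebra.Properties.CommutativeSemigroup +-commutativeSemigroup using (x∙yz≈y∙xz)
  open import Relation.Binary.Reasoning.Setoid setoid

  sumList : ∀ {a} {A : Set a} → (A → Carrier) → List A → Carrier
  sumList w xs = List.foldr _⊕_ 0# (List.map w xs)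

  module _ {a} {A : Set a} where

    sumList-cong : {v w : A → Carrier} (xs : List A) → (∀ {x} → x ∈ˡ xs → v x ≈ w x) →
                   sumList v xs ≈ sumList w xs
    sumList-cong []       h = ≈-refl
    sumList-cong (x ∷ xs) h = +-cong (h (here refl)) (sumList-cong xs (h ∘ there))

    sumList-++ : (w : A → Carrier) (xs ys : List A) →
                 sumList w (xs List.++ ys) ≈ sumList w xs ⊕ sumList w ys
    sumList-++ w []       ys = ≈-sym (+-identityˡ _)
    sumList-++ w (x ∷ xs) ys = ≈-trans (+-congˡ (sumList-++ w xs ys)) (≈-sym (+-assoc _ _ _))

    sumList-↭ : (w : A → Carrier) {xs ys : List A} → xs ↭ ys → sumList w xs ≈ sumList w ys
    sumList-↭ w ↭.refl          = ≈-refl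
    sumList-↭ w (↭.prep x p)    = +-congˡ (sumList-↭ w p)
    sumList-↭ w (↭.swap {xs} {ys} x y p) = begin
      w x ⊕ (w y ⊕ sumList w xs) ≈⟨ +-congˡ (+-congˡ (sumList-↭ w p)) ⟩
      w x ⊕ (w y ⊕ sumList w ys) ≈⟨ +-assoc _ _ _ ⟨
      w x ⊕ w y ⊕ sumList w ys   ≈⟨ +-congʳ (+-comm _ _) ⟩
      w y ⊕ w x ⊕ sumList w ys   ≈⟨ +-assoc _ _ _ ⟩
      w y ⊕ (w x ⊕ sumList w ys) ∎
    sumList-↭ w (↭.trans p q)   = ≈-trans (sumList-↭ w p) (sumList-↭ w q)

  sumList-map : ∀ {a b} {A : Set a} {B : Set b} (w : B → Carrier) (f : A → B) (xs : List A) →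
                sumList w (List.map f xs) ≡ sumList (w ∘ f) xs
  sumList-map w f xs = cong (List.foldr _⊕_ 0#) (sym (map-∘ xs))

  sumList-concatMap : ∀ {a b} {A : Set a} {B : Set b} (w : B → Carrier) (f : A → List B) (xs : List A) →
                      sumList w (List.concatMap f xs) ≈ sumList (sumList w ∘ f) xs
  sumList-concatMap w f []       = ≈-refl
  sumList-concatMap w f (x ∷ xs) =
    ≈-trans (sumList-++ w (f x) _) (+-congˡ (sumList-concatMap w f xs))

  g : Series
  g = X/[1-X]

  g-zero : g 0 ≈ 0#
  g-zero = ≈-trans (+-identityʳ _) (zeroˡ _)

  g-suc : ∀ n → g (suc n) ≈ 1#
  g-suc n = begin
    0# * 1# ⊕ (1# * 1# ⊕ ∑ {n} (λ _ → 0# * 1#))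
      ≈⟨ +-cong (zeroˡ _) (+-cong (*-identityʳ _) (sum-cong-≋ {n} (λ _ → zeroˡ _))) ⟩
    0# ⊕ (1# ⊕ ∑ {n} (λ _ → 0#))
      ≈⟨ +-identityˡ _ ⟩
    1# ⊕ ∑ {n} (λ _ → 0#)
      ≈⟨ +-congˡ (sum-replicate-zero n) ⟩
    1# ⊕ 0#
      ≈⟨ +-identityʳ _ ⟩
    1# ∎

  g*-zero : ∀ f → (g *ˢ f) 0 ≈ 0#
  g*-zero f = ≈-trans (+-identityʳ _) (≈-trans (*-congʳ g-zero) (zeroˡ _))

  g*-suc : ∀ f n → (g *ˢ f) (suc n) ≈ ∑ {suc n} λ i → f (n ∸ toℕ i)
  g*-suc f n = begin
    g 0 * f (suc n) ⊕ ∑ {suc n} (λ i → g (suc (toℕ i)) * f (n ∸ toℕ i))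
      ≈⟨ +-cong (≈-trans (*-congʳ g-zero) (zeroˡ _))
           (sum-cong-≋ {suc n} λ i → ≈-trans (*-congʳ (g-suc (toℕ i))) (*-identityˡ (f (n ∸ toℕ i)))) ⟩
    0# ⊕ ∑ {suc n} (λ i → f (n ∸ toℕ i))
      ≈⟨ +-identityˡ _ ⟩
    ∑ {suc n} (λ i → f (n ∸ toℕ i)) ∎

  g*-one : ∀ f → (g *ˢ f) 1 ≈ f 0
  g*-one f = ≈-trans (g*-suc f 0) (+-identityʳ _)

  -- The identity g = x + xg, multiplied by `f` and read off at one coefficient.
  g*-suc-suc : ∀ f n → (g *ˢ f) (suc (suc n)) ≈ f (suc n) ⊕ (g *ˢ f) (suc n)
  g*-suc-suc f n = ≈-trans (g*-suc f (suc n)) (+-congˡ (≈-sym (g*-suc f n)))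

  -- The coefficients of the powers of x/(1-x) obey Pascal's rule, as do the
  -- numbers of subsets of given size.
  sum-allSubsets : ∀ m (F : ℕ → Carrier) N → m < N →
    sumList (F ∘ ∣_∣) (allSubsets m) ≈ ∑ {N} λ l → F (toℕ l) * (g ^ˢ suc (toℕ l)) (suc m)
  sum-allSubsets zero F (suc N) _ = +-cong
    (≈-sym (≈-trans (*-congˡ (g*-one 1ˢ)) (*-identityʳ _)))
    -- The second and higher powers of `g` have no term in x.
    (≈-sym (≈-trans
      (sum-cong-≋ {N} λ l → ≈-trans
        (*-congˡ (≈-trans (g*-one (g ^ˢ suc (toℕ l))) (g*-zero (g ^ˢ toℕ l)))) (zeroʳ _))
      (sum-replicate-zero N)))
  sum-allSubsets (suc m) F (suc N) (s≤s m<N) = begin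
    sumList (F ∘ ∣_∣) (List.map (true ∷_) W List.++ (List.map (false ∷_) W List.++ []))
      ≈⟨ sumList-++ (F ∘ ∣_∣) (List.map (true ∷_) W) _ ⟩
    sumList (F ∘ ∣_∣) (List.map (true ∷_) W) ⊕
    sumList (F ∘ ∣_∣) (List.map (false ∷_) W List.++ [])
      ≈⟨ +-cong (reflexive (sumList-map (F ∘ ∣_∣) (true ∷_) W))
           (≈-trans (sumList-++ (F ∘ ∣_∣) (List.map (false ∷_) W) []) (≈-trans (+-identityʳ _)
             (reflexive (sumList-map (F ∘ ∣_∣) (false ∷_) W)))) ⟩
    sumList (F ∘ suc ∘ ∣_∣) W ⊕ sumList (F ∘ ∣_∣) W
      -- A `true` in front raises the size by one, hence the shifted `F`. The two instances need
      -- different numbers of terms, which is why `N` is any bound above `m`.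
      ≈⟨ +-cong (sum-allSubsets m (F ∘ suc) N m<N) (sum-allSubsets m F (suc N) (m<n⇒m<1+n m<N)) ⟩
    ∑ {N} (term 1 0) ⊕ (F 0 * G 0 m ⊕ ∑ {N} (term 1 1))
      ≈⟨ x∙yz≈y∙xz _ _ _ ⟩
    F 0 * G 0 m ⊕ (∑ {N} (term 1 0) ⊕ ∑ {N} (term 1 1))
      ≈⟨ +-cong (*-congˡ (≈-sym (≈-trans (g*-suc-suc 1ˢ m) (+-identityˡ _))))
           (≈-sym (∑-distrib-+ {N} (term 1 0) (term 1 1))) ⟩
    F 0 * G 0 (suc m) ⊕ ∑ {N} (λ l → term 1 0 l ⊕ term 1 1 l)
      ≈⟨ +-congˡ (sum-cong-≋ {N} λ l → ≈-trans (≈-sym (distribˡ _ _ _))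
           (*-congˡ (≈-sym (g*-suc-suc (g ^ˢ suc (toℕ l)) m)))) ⟩
    F 0 * G 0 (suc m) ⊕ ∑ {N} (λ l → F (suc (toℕ l)) * G (suc (toℕ l)) (suc m)) ∎
    where
    W = allSubsets m

    G : ℕ → ℕ → Carrier
    G l n = (g ^ˢ suc l) (suc n)

    term : ℕ → ℕ → Fin N → Carrier
    term i j l = F (i + toℕ l) * G (j + toℕ l) m

  module _ {b c : Weight} (isWeightC : IsWeightC b c) where

    -- The weights `c` are compared with `b` through the tuple formed by `σ` and `sizes d`.
    sum-imageΦ : (d : Subset n) → sumList c (imageΦ d) ≈ seriesB b (suc ∣ d ∣)
    sum-imageΦ d = ≈-trans (reflexive (sumList-map c (Φ d) (partitionsPC⁺ ∣ d ∣)))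
      (sumList-cong (partitionsPC⁺ ∣ d ∣) λ {σ} σ∈ → isWeightC σ (sizes d) (Φ d σ)
        (to (∈-partitionsPC⁺ σ) σ∈) (sizes-positive d) (sum-sizes d) (isΦ d σ))

    seriesC≈seriesB∘ : seriesC c ≈ˢ seriesB b ∘ˢ X/[1-X]
    seriesC≈seriesB∘ zero    = ≈-sym (≈-trans (+-identityʳ _) (zeroˡ _))
    seriesC≈seriesB∘ (suc m) = begin
      sumList c (partitionsCO m)
        ≈⟨ sumList-↭ c (partitionsCO↭imagesΦ m) ⟩
      sumList c (imagesΦ m)
        ≈⟨ sumList-concatMap c imageΦ (allSubsets m) ⟩
      sumList (sumList c ∘ imageΦ) (allSubsets m)
        ≈⟨ sumList-cong (allSubsets m) (λ {d} _ → sum-imageΦ d) ⟩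
      sumList (λ d → seriesB b (suc ∣ d ∣)) (allSubsets m)
        ≈⟨ sum-allSubsets m (seriesB b ∘ suc) (suc m) (n<1+n m) ⟩
      ∑ {suc m} (λ l → seriesB b (suc (toℕ l)) * (g ^ˢ suc (toℕ l)) (suc m))
        -- The composition also has a summand of index 0, which vanishes because `seriesB b` has
        -- constant term 0.
        ≈⟨ +-identityˡ _ ⟨
      0# ⊕ ∑ {suc m} (λ l → seriesB b (suc (toℕ l)) * (g ^ˢ suc (toℕ l)) (suc m))
        ≈⟨ +-congʳ (zeroˡ _) ⟨
      (seriesB b ∘ˢ X/[1-X]) (suc m) ∎

lemma2p8 : ∀ {r ℓ} (R : CommutativeRing r ℓ) →
    let open Weighted R in
    (a b c : Weight) → IsWeightB a b → IsWeightC b c →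
    seriesC c ≈ˢ seriesB b ∘ˢ X/[1-X]
lemma2p8 R a b c _ isWeightC = seriesC≈seriesB∘ R isWeightC
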